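{- Let $A$ be a finite alphabet with $|A|\geq 2$, let $\mathtt a\in A$, and let $X$ be a set of variables. Given an equation $U=V$, with $U,V\in (A\cup X)^*$, with linear length constraints $\theta$, there exists a system $\mathcal S$ of positive and negative equations $U_i =V_i$ or $U_i\neq V_i$ with $U_i,V_i\in (X'\cup\{\mathtt a\})^*$, for a set of variables $X'$ with $X\subset X'$, together with linear length constraints on the variables of $X'$, such that $\mathcal S$ (with its length constraints) is satisfiable over $A$ if and only if $U=V$ (with the length constraints $\theta$) is satisfiable over $A$.
   Context: Variables are disjoint from $A$. A substitution is a morphism $h$ from words over constants and variables to $A^*$ with $h(c)=c$ for all $c\in A$; it satisfies $U=V$ if $h(U)=h(V)$ and $U\ne V$ if $h(U)\neq h(V)$. A set of linear length constraints is a system of linear Diophantine equations whose unknowns are the lengths $|h(x)|$ of the values of the variables. An equation, or a system of positive and negative equations, with linear length constraints is satisfiable over $A$ if there is a substitution satisfying all (positive and negative) equations whose lengths satisfy all the length constraints. -}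

module Defs where

open import Algebra.Morphism.Structures using (IsMonoidHomomorphism)
open import Data.Integer.Base using (ℤ; +_; _+_; _*_; 0ℤ)
open import Data.List.Base using (List; []; _∷_; [_]; length; ++-[]-rawMonoid)
open import Data.List.Relation.Unary.All using (All)
open import Data.Product.Base using (_×_; _,_; ∃-syntax)
open import Data.Sum.Base using (_⊎_; inj₁; inj₂)
open import Data.Unit.Polymorphic.Base using (⊤)
open import Level using (Level; _⊔_)
open import Relation.Binary.PropositionalEquality.Core using (_≡_; _≢_)

private
  variable
    ℓa ℓx : Level

-- The disjoint sum makes constants (inj₁) and variables (inj₂) disjoint.
Word : Set ℓa → Set ℓx → Set (ℓa ⊔ ℓx)
Word A X = List (A ⊎ X)

record Substitution (A : Set ℓa) (X : Set ℓx) : Set (ℓa ⊔ ℓx) where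
  field
    ⟦_⟧           : Word A X → List A
    isMorphism    : IsMonoidHomomorphism (++-[]-rawMonoid (A ⊎ X)) (++-[]-rawMonoid A) ⟦_⟧
    fixesConstant : ∀ c → ⟦ [ inj₁ c ] ⟧ ≡ [ c ]

data Literal (A : Set ℓa) (X : Set ℓx) : Set (ℓa ⊔ ℓx) where
  _≐_ _≠_ : (U V : Word A X) → Literal A X

infix 4 _≐_ _≠_

System : Set ℓa → Set ℓx → Set (ℓa ⊔ ℓx)
System A X = List (Literal A X)

-- Finitely many terms k · |h(x)|, so that X itself need not be finite;
-- repeated variables add up.
record LengthEquation (X : Set ℓx) : Set ℓx where
  constructor _≐ᴸ_
  field
    terms    : List (ℤ × X)
    constant : ℤ

LengthConstraints : Set ℓx → Set ℓx
LengthConstraints X = List (LengthEquation X)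

module _ {A : Set ℓa} {X : Set ℓx} (h : Substitution A X) where
  open Substitution h

  SatisfiesLiteral : Literal A X → Set ℓa
  SatisfiesLiteral (U ≐ V) = ⟦ U ⟧ ≡ ⟦ V ⟧
  SatisfiesLiteral (U ≠ V) = ⟦ U ⟧ ≢ ⟦ V ⟧

  lengthSum : List (ℤ × X) → ℤ
  lengthSum []             = 0ℤ
  lengthSum ((k , x) ∷ ts) = k * + length ⟦ [ inj₂ x ] ⟧ + lengthSum ts

  SatisfiesLength : LengthEquation X → Set
  SatisfiesLength (ts ≐ᴸ c) = lengthSum ts ≡ c

Satisfiable : {A : Set ℓa} {X : Set ℓx} → System A X → LengthConstraints X → Set (ℓa ⊔ ℓx)
Satisfiable {A = A} {X = X} S θ =
  ∃[ h ] (All (SatisfiesLiteral {A = A} {X = X} h) S × All (SatisfiesLength h) θ)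

-- Membership of a word in (X ∪ {a})*.
OnlyConstant : {A : Set ℓa} {X : Set ℓx} → A → Word A X → Set (ℓa ⊔ ℓx)
OnlyConstant {ℓa} {ℓx} {A} {X} a = All allowed
  where
  allowed : A ⊎ X → Set ℓa
  allowed (inj₁ c) = c ≡ a
  allowed (inj₂ _) = ⊤

LiteralOnlyConstant : {A : Set ℓa} {X : Set ℓx} → A → Literal A X → Set (ℓa ⊔ ℓx)
LiteralOnlyConstant a (U ≐ V) = OnlyConstant a U × OnlyConstant a V
LiteralOnlyConstant a (U ≠ V) = OnlyConstant a U × OnlyConstant a V

{-# OPTIONS --safe #-}

-- Replace every constant, including a, by a fresh variable of length 1, the
-- fresh variables being pairwise distinct.  A solution sends them to distinct
-- letters, so some letter-to-letter map sends each of these letters back to the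
-- constant it stands for; applying it to the solution preserves lengths and the
-- equation, and restores the constants.
module Submission where

open import Defs
open import Algebra.Morphism.Construct.Composition using (isMonoidHomomorphism)
open import Algebra.Morphism.Structures using (IsMonoidHomomorphism)
open import Data.Fin.Base using (Fin)
open import Data.Fin.Properties using (any?; _≟_)
open import Data.Integer.Base using (+_; _*_; _+_; 1ℤ)
open import Data.Integer.Properties using (+-identityʳ; *-identityˡ; +-injective)
open import Data.List.Base
  using (List; []; _∷_; [_]; map; length; filter; cartesianProduct; allFin; _++_; ++-[]-rawMonoid)
open import Data.List.Membership.Propositional.Properties
  using (∈-filter⁺; ∈-cartesianProduct⁺; ∈-allFin)
open import Data.List.Properties using (map-++; map-id; map-∘; map-cong; length-map; ∷-injectiveˡ)
open import Data.List.Relation.Unary.All as All using (All; []; _∷_)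
open import Data.List.Relation.Unary.All.Properties as All using (all-filter)
open import Data.Nat.Base using (ℕ; _≤_)
open import Data.Product.Base using (Σ-syntax; ∃-syntax; _×_; _,_; proj₁; proj₂; map₂; uncurry)
open import Data.Sum.Base using (_⊎_; inj₁; inj₂; [_,_]′)
open import Data.Sum.Properties using (inj₁-injective)
open import Data.Unit.Polymorphic.Base using (tt)
open import Function.Base using (id; _∘_)
open import Function.Bundles using (_↔_; _↣_; _⇔_; mk↣; mk⇔; module Inverse)
open import Function.Definitions using (Injective)
open import Level using (Level)
open import Relation.Binary.PropositionalEquality
  using (_≡_; _≗_; refl; sym; trans; cong; cong₂; module ≡-Reasoning)
open import Relation.Nullary using (¬?; yes; no; contradiction)
open import Relation.Nullary.Decidable using (decidable-stable)

private
  variable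
    ℓa ℓb ℓx ℓy : Level

map-isMonoidHomomorphism : {A : Set ℓa} {B : Set ℓb} (f : A → B) →
  IsMonoidHomomorphism (++-[]-rawMonoid A) (++-[]-rawMonoid B) (map f)
map-isMonoidHomomorphism f = record
  { isMagmaHomomorphism = record
    { isRelHomomorphism = record { cong = cong (map f) }
    ; homo              = map-++ f
    }
  ; ε-homo = refl
  }

module _ {A : Set ℓa} {X : Set ℓx} {Y : Set ℓy} (h : Substitution A X) where
  open Substitution h

  -- A composite of homomorphisms is a homomorphism, so neither `π` nor `φ` has to fix constants by
  -- itself; only their joint effect on constants must be checked. Both directions of the theorem
  -- build their substitution this way.
  conjugate : (π : A → A) (φ : A ⊎ Y → A ⊎ X) →
    (∀ c → map π ⟦ [ φ (inj₁ c) ] ⟧ ≡ [ c ]) → Substitution A Y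
  conjugate π φ fixes = record
    { ⟦_⟧           = map π ∘ ⟦_⟧ ∘ map φ
    ; isMorphism    = isMonoidHomomorphism trans
        (isMonoidHomomorphism trans (map-isMonoidHomomorphism φ) isMorphism)
        (map-isMonoidHomomorphism π)
    ; fixesConstant = fixes
    }

renameLength : {X : Set ℓx} {Y : Set ℓy} → (X → Y) → LengthEquation X → LengthEquation Y
renameLength g (ts ≐ᴸ c) = map (map₂ g) ts ≐ᴸ c

module _ {A : Set ℓa} {X : Set ℓx} {Y : Set ℓy} (h : Substitution A X) (k : Substitution A Y)
  (g : X → Y)
  (same : ∀ x → length (Substitution.⟦_⟧ k [ inj₂ (g x) ]) ≡ length (Substitution.⟦_⟧ h [ inj₂ x ]))
  where

  lengthSum-rename : ∀ ts → lengthSum k (map (map₂ g) ts) ≡ lengthSum h ts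
  lengthSum-rename []             = refl
  lengthSum-rename ((z , x) ∷ ts) =
    cong₂ (λ l s → z * + l + s) (same x) (lengthSum-rename ts)

  renameLength⁺ : ∀ {θ} → All (SatisfiesLength h) θ → All (SatisfiesLength k) (map (renameLength g) θ)
  renameLength⁺ = All.map⁺ ∘ All.map (λ { {ts ≐ᴸ _} → trans (lengthSum-rename ts) })

  renameLength⁻ : ∀ {θ} → All (SatisfiesLength k) (map (renameLength g) θ) → All (SatisfiesLength h) θ
  renameLength⁻ = All.map (λ { {ts ≐ᴸ _} → trans (sym (lengthSum-rename ts)) }) ∘ All.map⁻

hasLengthOne : {X : Set ℓx} → X → LengthEquation X
hasLengthOne x = [ (1ℤ , x) ] ≐ᴸ 1ℤ

module _ {A : Set ℓa} {X : Set ℓx} (h : Substitution A X) (x : X) where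
  open Substitution h

  lengthSum-single : lengthSum h [ (1ℤ , x) ] ≡ + length ⟦ [ inj₂ x ] ⟧
  lengthSum-single = trans (+-identityʳ _) (*-identityˡ _)

  letter⇒hasLengthOne : ∀ {c} → ⟦ [ inj₂ x ] ⟧ ≡ [ c ] → SatisfiesLength h (hasLengthOne x)
  letter⇒hasLengthOne eq = trans lengthSum-single (cong (+_ ∘ length) eq)

  hasLengthOne⇒letter : SatisfiesLength h (hasLengthOne x) → ∃[ c ] ⟦ [ inj₂ x ] ⟧ ≡ [ c ]
  hasLengthOne⇒letter p with ⟦ [ inj₂ x ] ⟧ | +-injective (trans (sym lengthSum-single) p)
  ... | c ∷ [] | refl = c , refl

-- Both orders of each pair are kept, so that membership follows from `i ≢ j` alone, without
-- comparing sizes.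
distinctPairs : ∀ n → List (Fin n × Fin n)
distinctPairs n = filter (¬? ∘ uncurry _≟_) (cartesianProduct (allFin n) (allFin n))

module Encoding {A : Set ℓa} {n : ℕ} (A↔Fin : A ↔ Fin n) (X : Set ℓx) where
  open Inverse A↔Fin using (to; from; strictlyInverseˡ; strictlyInverseʳ)

  -- The fresh variables are indexed by `Fin n` instead of `A`, which keeps `X′` at the level of `X`
  -- and gives a finite list of all fresh variables.
  X′ : Set ℓx
  X′ = X ⊎ Fin n

  fresh : Fin n → Word A X′
  fresh i = [ inj₂ (inj₂ i) ]

  encode : A ⊎ X → A ⊎ X′
  encode = inj₂ ∘ [ inj₂ ∘ to , inj₁ ]′

  -- Constants stay in place, since a substitution over `X′` built from `decode` still has to fix
  -- them.
  decode : A ⊎ X′ → A ⊎ X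
  decode = [ inj₁ , [ inj₂ , inj₁ ∘ from ]′ ]′

  decode-encode : decode ∘ encode ≗ id
  decode-encode (inj₁ c) = cong inj₁ (strictlyInverseʳ c)
  decode-encode (inj₂ x) = refl

  distinct : Fin n × Fin n → Literal A X′
  distinct (i , j) = fresh i ≠ fresh j

  system : Word A X → Word A X → System A X′
  system U V = (map encode U ≐ map encode V) ∷ map distinct (distinctPairs n)

  constraints : LengthConstraints X → LengthConstraints X′
  constraints θ = map (renameLength inj₁) θ ++ map (hasLengthOne ∘ inj₂) (allFin n)

  system-onlyConstant : ∀ a U V → All (LiteralOnlyConstant a) (system U V)
  system-onlyConstant a U V =
    (onlyConstant U , onlyConstant V) ∷
    All.map⁺ (All.universal (λ _ → (tt ∷ []) , (tt ∷ [])) (distinctPairs n))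
    where
    onlyConstant : ∀ W → OnlyConstant a (map encode W)
    onlyConstant W = All.map⁺ (All.universal (λ _ → tt) W)

  from-injective : Injective _≡_ _≡_ from
  from-injective eq = trans (sym (strictlyInverseˡ _)) (trans (cong to eq) (strictlyInverseˡ _))

  to-injective : Injective _≡_ _≡_ to
  to-injective eq = trans (sym (strictlyInverseʳ _)) (trans (cong from eq) (strictlyInverseʳ _))

  -- A letter `f i` can be traced back to `i` by a finite search, and injectivity makes the answer
  -- independent of which index is found.
  leftInverse : (f : Fin n → A) → Injective _≡_ _≡_ f → ∃[ π ] (∀ i → π (f i) ≡ from i)
  leftInverse f f-injective = π , π-inverse
    where
    π : A → A
    -- Letters are compared through their indices, where equality is decidable.
    π c with any? (λ i → to (f i) ≟ to c)
    ... | yes (i , _) = from i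
    -- Default outside the image of `f`; the required property concerns only the image.
    ... | no _        = c

    π-inverse : ∀ i → π (f i) ≡ from i
    π-inverse i with any? (λ j → to (f j) ≟ to (f i))
    ... | yes (j , eq) = cong from (f-injective (to-injective eq))
    ... | no ∄j        = contradiction (i , refl) ∄j

  module _ {U V : Word A X} {θ : LengthConstraints X} where

    complete : Satisfiable [ U ≐ V ] θ → Satisfiable (system U V) (constraints θ)
    complete (h , hU≡hV ∷ [] , hθ) = k , equation ∷ disequations , lengths
      where
      open Substitution h
      k : Substitution A X′
      -- Old variables keep their values under `h`, and the fresh variable `i` takes the letter
      -- `from i` as its value.
      k = conjugate h id decode (λ c → trans (map-id _) (fixesConstant c))

      k-encode : ∀ W → Substitution.⟦_⟧ k (map encode W) ≡ ⟦ W ⟧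
      k-encode W = begin
        map id ⟦ map decode (map encode W) ⟧ ≡⟨ map-id _ ⟩
        ⟦ map decode (map encode W) ⟧        ≡⟨ cong ⟦_⟧ (map-∘ W) ⟨
        ⟦ map (decode ∘ encode) W ⟧          ≡⟨ cong ⟦_⟧ (map-cong decode-encode W) ⟩
        ⟦ map id W ⟧                         ≡⟨ cong ⟦_⟧ (map-id W) ⟩
        ⟦ W ⟧                                ∎
        where open ≡-Reasoning

      k-fresh : ∀ i → Substitution.⟦_⟧ k (fresh i) ≡ [ from i ]
      k-fresh i = trans (map-id _) (fixesConstant (from i))

      equation : SatisfiesLiteral k (map encode U ≐ map encode V)
      equation = trans (k-encode U) (trans hU≡hV (sym (k-encode V)))

      disequations : All (SatisfiesLiteral k) (map distinct (distinctPairs n))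
      disequations = All.map⁺ (All.map
        (λ {(i , j)} i≢j eq →
          i≢j (from-injective (∷-injectiveˡ (trans (sym (k-fresh i)) (trans eq (k-fresh j))))))
        (all-filter (¬? ∘ uncurry _≟_) (cartesianProduct (allFin n) (allFin n))))

      lengths : All (SatisfiesLength k) (constraints θ)
      lengths = All.++⁺
        (renameLength⁺ h k inj₁ (λ x → length-map id ⟦ [ inj₂ x ] ⟧) hθ)
        (All.map⁺ (All.universal (λ i → letter⇒hasLengthOne k (inj₂ i) (k-fresh i)) (allFin n)))

    sound : Satisfiable (system U V) (constraints θ) → Satisfiable [ U ≐ V ] θ
    -- By definition `k` sends `U` to the image under `map π` of what `h` assigns to the encoded
    -- `U`, so the equation transfers by congruence.
    sound (h , hU≡hV ∷ disequations , lengths) = k , cong (map π) hU≡hV ∷ [] , kθ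
      where
      open Substitution h
      letter : ∀ i → ∃[ c ] ⟦ fresh i ⟧ ≡ [ c ]
      letter i = hasLengthOne⇒letter h (inj₂ i)
        (All.lookup (All.map⁻ (All.++⁻ʳ (map (renameLength inj₁) θ) lengths)) (∈-allFin i))

      f : Fin n → A
      f = proj₁ ∘ letter

      f-injective : Injective _≡_ _≡_ f
      -- The disequations only refute `i ≢ j`; decidable equality of indices removes the double
      -- negation.
      f-injective {i} {j} fi≡fj = decidable-stable (i ≟ j) λ i≢j →
        All.lookup (All.map⁻ disequations)
          (∈-filter⁺ (¬? ∘ uncurry _≟_) (∈-cartesianProduct⁺ (∈-allFin i) (∈-allFin j)) i≢j)
          (trans (proj₂ (letter i)) (trans (cong [_] fi≡fj) (sym (proj₂ (letter j)))))

      π : A → A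
      π = proj₁ (leftInverse f f-injective)

      restores : ∀ c → map π ⟦ fresh (to c) ⟧ ≡ [ c ]
      restores c = begin
        map π ⟦ fresh (to c) ⟧ ≡⟨ cong (map π) (proj₂ (letter (to c))) ⟩
        [ π (f (to c)) ]       ≡⟨ cong [_] (proj₂ (leftInverse f f-injective) (to c)) ⟩
        [ from (to c) ]        ≡⟨ cong [_] (strictlyInverseʳ c) ⟩
        [ c ]                  ∎
        where open ≡-Reasoning

      k : Substitution A X
      k = conjugate h π encode restores

      kθ : All (SatisfiesLength k) θ
      -- Here `h` is the substitution on the renamed side, and `k` differs from it on old variables
      -- only by a letter-to-letter map.
      kθ = renameLength⁻ k h inj₁ (λ x → sym (length-map π ⟦ [ inj₂ (inj₁ x) ] ⟧))
        (All.++⁻ˡ (map (renameLength inj₁) θ) lengths)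

theorem5p2 : {ℓa ℓx : Level} (A : Set ℓa) (n : ℕ) → A ↔ Fin n → 2 ≤ n →
    (a : A) (X : Set ℓx) (U V : Word A X) (θ : LengthConstraints X) →
    Σ[ X′ ∈ Set ℓx ] (X ↣ X′) ×
    (Σ[ S ∈ System A X′ ] Σ[ θ′ ∈ LengthConstraints X′ ]
    (All (LiteralOnlyConstant a) S ×
    (Satisfiable S θ′ ⇔ Satisfiable [ U ≐ V ] θ)))
theorem5p2 A n A↔Fin _ a X U V θ =
  X′ , mk↣ inj₁-injective , system U V , constraints θ ,
  system-onlyConstant a U V , mk⇔ sound complete
  where open Encoding A↔Fin X
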